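{- For every formula $A$ of $\mathbf{L_1}$: $\vdash_{\mathbf{HL_1}}A$ if and only if $\dashv_H A$ (i.e. $A$ is a theorem of $\mathbf{HAR}$).
   Context: Formulas of $\mathbf{L_1}$: built from atomic formulas $\epsilon ab$ ($a,b$ name variables, possibly equal) with primitive connectives $\vee,\sim$; $\wedge,\supset,\equiv$ defined as usual. Disjunctions may be associated in any way. $\vdash_H A$: $A$ belongs to the smallest set containing all instances of classical propositional tautologies and all formulas $\epsilon ab\supset\epsilon aa$, $(\epsilon ab\wedge\epsilon bc)\supset\epsilon ac$, $(\epsilon ab\wedge\epsilon bb)\supset\epsilon ba$, closed under modus ponens. Positive/negative parts (occurrences): $A$ is a positive part of $A$; if $B\vee C$ is a positive part then $B,C$ are positive parts; if $\sim B$ is a positive part then $B$ is a negative part; if $\sim B$ is a negative part then $B$ is a positive part. $F[B_+,B_-]$ denotes a formula in which some $B$ has one occurrence as positive part and another non-overlapping occurrence as negative part. Hintikka formula: a formula $H$ such that (1) $H$ is not of the form $F[B_+,B_-]$; (2) if $B\vee C$ is a negative part of $H$ then $B$ or $C$ is; (3) if $\epsilon ab$ is a negative part then so is $\epsilon aa$; (4) if $\epsilon ab,\epsilon bc$ are negative parts then so is $\epsilon ac$; (5) if $\epsilon ab,\epsilon bb$ are negative parts then so is $\epsilon ba$. $\mathbf{HAR}$: fix a name variable $a_0$; $\dashv_H$ is the smallest set such that $\dashv_H\epsilon a_0a_0$; $\dashv_H\sim\epsilon a_0a_0$; if $\vdash_H A\supset B$ and $\dashv_H B$ then $\dashv_H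 A$; if $\dashv_H A$ and $A$ is obtained from $B$ by uniform substitution of name variables for name variables then $\dashv_H B$; if $A$ is a Hintikka formula that is a disjunction of atomic or negated atomic formulas, $\dashv_H A$, and $\epsilon ab$ is not a negative part of $A$, then $\dashv_H A\vee\epsilon ab$. $\mathbf{HL_1}$: $\vdash_{\mathbf{HL_1}}$ is the smallest set of formulas containing every Hintikka formula and such that $\vdash_H A\supset B$ and $\vdash_{\mathbf{HL_1}}B$ imply $\vdash_{\mathbf{HL_1}}A$. -}

module Defs where

open import Data.Bool.Base using (Bool; true; not) renaming (_∨_ to _or_)
open import Data.List.Base using (List; []; _∷ʳ_)
open import Data.List.Relation.Binary.Prefix.Heterogeneous using (Prefix)
open import Data.Nat.Base using (ℕ)
open import Data.Product.Base using (_×_; _,_; ∃-syntax)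
open import Data.Sum.Base using (_⊎_)
open import Relation.Binary.PropositionalEquality.Core using (_≡_)
open import Relation.Nullary.Negation.Core using (¬_)

infix  9 ~_
infixr 7 _∧_
infixr 6 _∨_
infixr 5 _⊃_
infix  4 ⊢H_ ⊢HL₁_ HAR[_]⊣_

-- With V = ℕ these are the formulas of classical propositional logic, with
-- V = Name × Name the formulas of L₁.
data Formula (V : Set) : Set where
  atom : V → Formula V
  _∨_  : Formula V → Formula V → Formula V
  ~_   : Formula V → Formula V

_⊃_ _∧_ : ∀ {V} → Formula V → Formula V → Formula V
A ⊃ B = ~ A ∨ B
A ∧ B = ~ (~ A ∨ ~ B)

_[_] : ∀ {V W} → Formula V → (V → Formula W) → Formula W
atom x  [ σ ] = σ x
(A ∨ B) [ σ ] = A [ σ ] ∨ B [ σ ]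
(~ A)   [ σ ] = ~ (A [ σ ])

eval : ∀ {V} → (V → Bool) → Formula V → Bool
eval v (atom x) = v x
eval v (A ∨ B)  = eval v A or eval v B
eval v (~ A)    = not (eval v A)

Tautology : Formula ℕ → Set
Tautology P = ∀ v → eval v P ≡ true

Name : Set
Name = ℕ

L₁ : Set
L₁ = Formula (Name × Name)

pattern ε a b = atom (a , b)

rename : (Name → Name) → L₁ → L₁
rename σ A = A [ (λ (a , b) → ε (σ a) (σ b)) ]

data ⊢H_ : L₁ → Set where
  taut : ∀ P (σ : ℕ → L₁) → Tautology P → ⊢H P [ σ ]
  ax₁  : ∀ a b   → ⊢H ε a b ⊃ ε a a
  ax₂  : ∀ a b c → ⊢H (ε a b ∧ ε b c) ⊃ ε a c
  ax₃  : ∀ a b   → ⊢H (ε a b ∧ ε b b) ⊃ ε b a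
  mp   : ∀ {A B} → ⊢H A ⊃ B → ⊢H A → ⊢H B

data Step : Set where
  left right under~ : Step

-- An occurrence of a subformula is the path to it from the root.
Path : Set
Path = List Step

-- PosAt A B p : the occurrence of B at path p is a positive part of A.
mutual
  data PosAt (A : L₁) : L₁ → Path → Set where
    here : PosAt A A []
    ∨ˡ   : ∀ {B C p} → PosAt A (B ∨ C) p → PosAt A B (p ∷ʳ left)
    ∨ʳ   : ∀ {B C p} → PosAt A (B ∨ C) p → PosAt A C (p ∷ʳ right)
    ~⁻   : ∀ {B p} → NegAt A (~ B) p → PosAt A B (p ∷ʳ under~)

  data NegAt (A : L₁) : L₁ → Path → Set where
    ~⁺   : ∀ {B p} → PosAt A (~ B) p → NegAt A B (p ∷ʳ under~)

NegPart : L₁ → L₁ → Set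
NegPart A B = ∃[ p ] NegAt A B p

NonOverlapping : Path → Path → Set
NonOverlapping p q = ¬ Prefix _≡_ p q × ¬ Prefix _≡_ q p

-- A is of the form F[B₊,B₋] for some B.
HasForm-F[B₊,B₋] : L₁ → Set
HasForm-F[B₊,B₋] A =
  ∃[ B ] ∃[ p ] ∃[ q ] (PosAt A B p × NegAt A B q × NonOverlapping p q)

record Hintikka (H : L₁) : Set where
  field
    consistent : ¬ HasForm-F[B₊,B₋] H
    neg-∨      : ∀ B C → NegPart H (B ∨ C) → NegPart H B ⊎ NegPart H C
    neg-ax₁    : ∀ a b → NegPart H (ε a b) → NegPart H (ε a a)
    neg-ax₂    : ∀ a b c → NegPart H (ε a b) → NegPart H (ε b c) → NegPart H (ε a c)
    neg-ax₃    : ∀ a b → NegPart H (ε a b) → NegPart H (ε b b) → NegPart H (ε b a)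

-- Disjunctions, associated in any way, of one or more atomic or negated
-- atomic formulas.
data LiteralDisjunction : L₁ → Set where
  pos : ∀ a b → LiteralDisjunction (ε a b)
  neg : ∀ a b → LiteralDisjunction (~ ε a b)
  _∨_ : ∀ {A B} → LiteralDisjunction A → LiteralDisjunction B → LiteralDisjunction (A ∨ B)

-- HAR[ a₀ ]⊣ A : A is a theorem of HAR (written ⊣_H A), where a₀ is the fixed
-- name variable of the axioms.
data HAR[_]⊣_ (a₀ : Name) : L₁ → Set where
  ax⁺    : HAR[ a₀ ]⊣ ε a₀ a₀
  ax⁻    : HAR[ a₀ ]⊣ ~ ε a₀ a₀
  detach : ∀ {A B} → ⊢H A ⊃ B → HAR[ a₀ ]⊣ B → HAR[ a₀ ]⊣ A
  subst  : ∀ σ {B} → HAR[ a₀ ]⊣ rename σ B → HAR[ a₀ ]⊣ B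
  extend : ∀ {A} a b → Hintikka A → LiteralDisjunction A → HAR[ a₀ ]⊣ A →
           ¬ NegPart A (ε a b) → HAR[ a₀ ]⊣ A ∨ ε a b

data ⊢HL₁_ : L₁ → Set where
  hintikka : ∀ {H} → Hintikka H → ⊢HL₁ H
  detach   : ∀ {A B} → ⊢H A ⊃ B → ⊢HL₁ B → ⊢HL₁ A

{-# OPTIONS --safe #-}
-- Both calculi derive exactly the formulas A falsified by some valuation that
-- is closed under the three axiom schemes.  A Hintikka formula is falsified by
-- making precisely its atomic negative parts true.  Conversely, if v falsifies
-- A, cut v down to the finitely many names of A and let H be the disjunction
-- of all ~ ε a b with ε a b true under v, followed by the ε a b that are false.
-- Then H is a Hintikka formula and A ⊃ H is a tautology.  HAR derives the
-- negated block by identifying all names with a₀ and then adds the remaining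
-- atoms one by one with its extension rule.
module Submission where

open import Data.Bool.Base using (Bool; true; false; not) renaming (_∨_ to _or_)
open import Data.Bool.Properties using (∨-conicalˡ; ∨-conicalʳ; ∨-zeroʳ; ∨-idem; not-injective) renaming (_≟_ to _≟ᵇ_)
open import Data.Empty using (⊥)
open import Data.List.Base using (List; []; _∷_; _∷ʳ_; _++_; filter; cartesianProduct)
open import Data.List.Membership.DecPropositional using (_∈?_)
open import Data.List.Membership.Propositional using (_∈_)
open import Data.List.Membership.Propositional.Properties using (∈-++⁺ˡ; ∈-++⁺ʳ; ∈-++⁻; ∈-filter⁺; ∈-filter⁻; ∈-cartesianProduct⁺; ∈-cartesianProduct⁻)
open import Data.List.Relation.Binary.Prefix.Heterogeneous using (Prefix; []; _∷_)
open import Data.List.Relation.Unary.All as All using (All; []; _∷_)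
open import Data.List.Relation.Unary.Any using (here; there)
open import Data.Nat.Base using (ℕ; zero; suc; _+_)
open import Data.Nat.Properties using (+-suc; +-identityʳ) renaming (_≟_ to _≟ℕ_)
open import Data.Product.Base using (_×_; _,_; ∃-syntax; proj₁; proj₂)
open import Data.Product.Properties using (≡-dec)
open import Data.Sum.Base using (inj₁; inj₂; [_,_]′)
open import Function.Base using (_∘_; const)
open import Function.Bundles using (_⇔_; mk⇔)
open import Relation.Binary.PropositionalEquality using (_≡_; refl; sym; trans; cong; cong₂)
  renaming (subst to transport)
open import Relation.Nullary.Decidable.Core using (Dec; yes; does)
open import Relation.Nullary.Decidable using (dec-true; dec-false)
open import Relation.Nullary.Negation.Core using (¬_; contradiction)

open import Defs

true≢false : ∀ {b} → b ≡ true → b ≡ false → ⊥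
true≢false refl ()

PosPart : L₁ → L₁ → Set
PosPart A B = ∃[ p ] PosAt A B p

-- Valuations

Valuation : Set
Valuation = Name × Name → Bool

record Closed (P : Name × Name → Set) : Set where
  field
    closed₁ : ∀ a b → P (a , b) → P (a , a)
    closed₂ : ∀ a b c → P (a , b) → P (b , c) → P (a , c)
    closed₃ : ∀ a b → P (a , b) → P (b , b) → P (b , a)

open Closed

-- Both directions are needed because the closure conditions mention `P` in premises and in
-- conclusions. Closure thus passes between truth under a valuation, list membership and negative
-- parts.
Closed-resp : ∀ {P Q : Name × Name → Set} →
              (∀ {x} → P x → Q x) → (∀ {x} → Q x → P x) → Closed P → Closed Q
Closed-resp to from c = record
  { closed₁ = λ a b q → to (closed₁ c a b (from q))
  ; closed₂ = λ a b d q r → to (closed₂ c a b d (from q) (from r))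
  ; closed₃ = λ a b q r → to (closed₃ c a b (from q) (from r))
  }

Model : Valuation → Set
Model v = Closed (λ x → v x ≡ true)

Falsifiable : L₁ → Set
Falsifiable A = ∃[ v ] (Model v × eval v A ≡ false)

eval-[] : ∀ {V W} (v : W → Bool) (σ : V → Formula W) A → eval v (A [ σ ]) ≡ eval (eval v ∘ σ) A
eval-[] v σ (atom x) = refl
eval-[] v σ (A ∨ B)  = cong₂ _or_ (eval-[] v σ A) (eval-[] v σ B)
eval-[] v σ (~ A)    = cong not (eval-[] v σ A)

⊃-intro : ∀ {V} (v : V → Bool) A B → (eval v A ≡ true → eval v B ≡ true) → eval v (A ⊃ B) ≡ true
⊃-intro v A B h with eval v A
... | true  = h refl
... | false = refl

⊃-elim : ∀ {V} (v : V → Bool) A B → eval v (A ⊃ B) ≡ true → eval v A ≡ true → eval v B ≡ true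
⊃-elim v A B h a with eval v A
... | true = h

∧-elim : ∀ {V} (v : V → Bool) A B → eval v (A ∧ B) ≡ true → eval v A ≡ true × eval v B ≡ true
∧-elim v A B h with eval v A | eval v B
... | true | true = refl , refl

⊃-contrapositive : ∀ {V} (v : V → Bool) A B → eval v (A ⊃ B) ≡ true → eval v B ≡ false → eval v A ≡ false
⊃-contrapositive v A B h b with eval v A
... | true  = contradiction b (true≢false h)
... | false = refl

⊢H-sound : ∀ {v A} → Model v → ⊢H A → eval v A ≡ true
⊢H-sound {v} m (taut P σ t) = trans (eval-[] v σ P) (t (eval v ∘ σ))
⊢H-sound {v} m (ax₁ a b)    = ⊃-intro v (ε a b) (ε a a) (closed₁ m a b)
⊢H-sound {v} m (ax₂ a b c)  = ⊃-intro v (ε a b ∧ ε b c) (ε a c) λ h →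
  let (ab , bc) = ∧-elim v (ε a b) (ε b c) h in closed₂ m a b c ab bc
⊢H-sound {v} m (ax₃ a b)    = ⊃-intro v (ε a b ∧ ε b b) (ε b a) λ h →
  let (ab , bb) = ∧-elim v (ε a b) (ε b b) h in closed₃ m a b ab bb
⊢H-sound {v} m (mp {A} {B} d e) = ⊃-elim v A B (⊢H-sound m d) (⊢H-sound m e)

Falsifiable-detach : ∀ {A B} → ⊢H A ⊃ B → Falsifiable B → Falsifiable A
Falsifiable-detach {A} {B} d (v , m , f) = v , m , ⊃-contrapositive v A B (⊢H-sound m d) f

-- Tautologies over ℕ suffice: code pairs by Cantor's diagonal walk.

next : ℕ × ℕ → ℕ × ℕ
next (zero  , b) = suc b , zero
next (suc a , b) = a , suc b

decode : ℕ → ℕ × ℕ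
decode zero    = zero , zero
decode (suc n) = next (decode n)

-- Along an antidiagonal each `next` moves one unit from the first coordinate to the second; the
-- induction takes `b` such steps.
decode-walk : ∀ n b {a c} → decode n ≡ (b + a , c) → ∃[ m ] decode m ≡ (a , b + c)
decode-walk n zero    e = n , e
decode-walk n (suc b) {a} {c} e =
  let (m , f) = decode-walk (suc n) b (cong next e) in m , trans f (cong (a ,_) (+-suc b c))

-- Walking the whole antidiagonal from `(n , zero)` ends at `(zero , n)`, and one more `next` opens
-- the following one.
decode-diagonal : ∀ n → ∃[ m ] decode m ≡ (n , zero)
decode-diagonal zero    = zero , refl
decode-diagonal (suc n) =
  let (k , e) = decode-diagonal n
      (m , f) = decode-walk k n (trans e (cong (_, zero) (sym (+-identityʳ n))))
  in suc m , trans (cong next f) (cong (λ j → suc j , zero) (+-identityʳ n))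

decode-surjective : ∀ x → ∃[ n ] decode n ≡ x
decode-surjective (a , b) =
  let (k , e) = decode-diagonal (b + a)
      (m , f) = decode-walk k b e
  in m , trans f (cong (a ,_) (+-identityʳ b))

encode : ℕ × ℕ → ℕ
encode = proj₁ ∘ decode-surjective

decode-encode : ∀ x → decode (encode x) ≡ x
decode-encode = proj₂ ∘ decode-surjective

[encode][decode] : ∀ A → (A [ atom ∘ encode ]) [ atom ∘ decode ] ≡ A
[encode][decode] (atom x) = cong atom (decode-encode x)
[encode][decode] (A ∨ B)  = cong₂ _∨_ ([encode][decode] A) ([encode][decode] B)
[encode][decode] (~ A)    = cong ~_ ([encode][decode] A)

-- `taut` takes a scheme over ℕ, so `A` is presented as an instance of its own coded copy; for this
-- it suffices that `decode` is a left inverse of `encode`.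
⊢H-valid : ∀ A → (∀ v → eval v A ≡ true) → ⊢H A
⊢H-valid A t = transport ⊢H_ ([encode][decode] A)
  (taut (A [ atom ∘ encode ]) (atom ∘ decode) λ v → trans (eval-[] v (atom ∘ encode) A) (t (v ∘ encode)))

⊢H-valid-⊃ : ∀ A B → (∀ v → eval v B ≡ false → eval v A ≡ false) → ⊢H A ⊃ B
-- `h v` is passed as an argument so that the `with` below also abstracts `eval v B` in its type.
⊢H-valid-⊃ A B h = ⊢H-valid (A ⊃ B) λ v → lemma v (h v)
  where
  lemma : ∀ v → (eval v B ≡ false → eval v A ≡ false) → eval v (A ⊃ B) ≡ true
  lemma v k with eval v B
  ... | true  = ∨-zeroʳ _
  ... | false = cong (λ b → not b or false) (k refl)

-- Parts

-- A false disjunction has two false disjuncts and negation swaps the values, so the falsity of the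
-- whole fixes the value of every part.
PosAt-false : ∀ {v A B p} → eval v A ≡ false → PosAt A B p → eval v B ≡ false
NegAt-true  : ∀ {v A B p} → eval v A ≡ false → NegAt A B p → eval v B ≡ true
PosAt-false f here    = f
PosAt-false f (∨ˡ o)  = ∨-conicalˡ _ _ (PosAt-false f o)
PosAt-false f (∨ʳ o)  = ∨-conicalʳ _ _ (PosAt-false f o)
PosAt-false f (~⁻ o)  = not-injective (NegAt-true f o)
NegAt-true  f (~⁺ o)  = not-injective (PosAt-false f o)

-- `PosAt` lengthens paths at the far end, so a new step at the root has to be carried through the
-- whole derivation.
PosAt-∨ˡ : ∀ {A B C p} → PosAt A C p → PosAt (A ∨ B) C (left ∷ p)
NegAt-∨ˡ : ∀ {A B C p} → NegAt A C p → NegAt (A ∨ B) C (left ∷ p)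
PosAt-∨ˡ here   = ∨ˡ here
PosAt-∨ˡ (∨ˡ o) = ∨ˡ (PosAt-∨ˡ o)
PosAt-∨ˡ (∨ʳ o) = ∨ʳ (PosAt-∨ˡ o)
PosAt-∨ˡ (~⁻ o) = ~⁻ (NegAt-∨ˡ o)
NegAt-∨ˡ (~⁺ o) = ~⁺ (PosAt-∨ˡ o)

PosAt-∨ʳ : ∀ {A B C p} → PosAt B C p → PosAt (A ∨ B) C (right ∷ p)
NegAt-∨ʳ : ∀ {A B C p} → NegAt B C p → NegAt (A ∨ B) C (right ∷ p)
PosAt-∨ʳ here   = ∨ʳ here
PosAt-∨ʳ (∨ˡ o) = ∨ˡ (PosAt-∨ʳ o)
PosAt-∨ʳ (∨ʳ o) = ∨ʳ (PosAt-∨ʳ o)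
PosAt-∨ʳ (~⁻ o) = ~⁻ (NegAt-∨ʳ o)
NegAt-∨ʳ (~⁺ o) = ~⁺ (PosAt-∨ʳ o)

-- The same occurrences read from the root; the Bool is the polarity, and
-- Occ s A t B p walks down from A (of polarity s) to B (of polarity t).
data Occ : Bool → L₁ → Bool → L₁ → Path → Set where
  []     : ∀ {s A} → Occ s A s A []
  left   : ∀ {s t A B C p} → Occ s A t C p → Occ s (A ∨ B) t C (left ∷ p)
  right  : ∀ {s t A B C p} → Occ s B t C p → Occ s (A ∨ B) t C (right ∷ p)
  under~ : ∀ {s t A C p} → Occ (not s) A t C p → Occ s (~ A) t C (under~ ∷ p)

Occ-∷ʳ : ∀ {s t u A B C p e} → Occ s A t B p → Occ t B u C (e ∷ []) → Occ s A u C (p ∷ʳ e)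
Occ-∷ʳ []         o = o
Occ-∷ʳ (left d)   o = left (Occ-∷ʳ d o)
Occ-∷ʳ (right d)  o = right (Occ-∷ʳ d o)
Occ-∷ʳ (under~ d) o = under~ (Occ-∷ʳ d o)

PosAt⇒Occ : ∀ {A B p} → PosAt A B p → Occ true A true B p
NegAt⇒Occ : ∀ {A B p} → NegAt A B p → Occ true A false B p
PosAt⇒Occ here   = []
PosAt⇒Occ (∨ˡ o) = Occ-∷ʳ (PosAt⇒Occ o) (left [])
PosAt⇒Occ (∨ʳ o) = Occ-∷ʳ (PosAt⇒Occ o) (right [])
PosAt⇒Occ (~⁻ o) = Occ-∷ʳ (NegAt⇒Occ o) (under~ [])
NegAt⇒Occ (~⁺ o) = Occ-∷ʳ (PosAt⇒Occ o) (under~ [])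

-- Nothing lies below an atom, so the two paths coincide, and a path from the root determines its
-- polarity.
prefix-polarity : ∀ {s t u A B x p q} → Prefix _≡_ p q →
                  Occ s A t (atom x) p → Occ s A u B q → t ≡ u
prefix-polarity []         []         []         = refl
prefix-polarity (refl ∷ i) (left d)   (left e)   = prefix-polarity i d e
prefix-polarity (refl ∷ i) (right d)  (right e)  = prefix-polarity i d e
prefix-polarity (refl ∷ i) (under~ d) (under~ e) = prefix-polarity i d e

atom-nonOverlapping : ∀ {A x p q} → PosAt A (atom x) p → NegAt A (atom x) q → NonOverlapping p q
atom-nonOverlapping o n =
  (λ i → true≢false refl (prefix-polarity i (PosAt⇒Occ o) (NegAt⇒Occ n))) ,
  (λ i → true≢false (prefix-polarity i (NegAt⇒Occ n) (PosAt⇒Occ o)) refl)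

-- Characteristic valuations

_∈ᵖ?_ : (x : Name × Name) (S : List (Name × Name)) → Dec (x ∈ S)
_∈ᵖ?_ = _∈?_ (≡-dec _≟ℕ_ _≟ℕ_)

char : List (Name × Name) → Valuation
char S x = does (x ∈ᵖ? S)

char-∈ : ∀ {S x} → x ∈ S → char S x ≡ true
char-∈ {S} {x} = dec-true (x ∈ᵖ? S)

∈-char : ∀ {S x} → char S x ≡ true → x ∈ S
∈-char {S} {x} e with x ∈ᵖ? S
... | yes x∈S = x∈S

-- Hintikka formulas are falsifiable

-- The atomic negative parts of a formula that itself occurs positively (⁺) or
-- negatively (⁻); a negative disjunction has no parts.
negAtoms⁺ negAtoms⁻ : L₁ → List (Name × Name)
negAtoms⁺ (atom x) = []
negAtoms⁺ (A ∨ B)  = negAtoms⁺ A ++ negAtoms⁺ B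
negAtoms⁺ (~ A)    = negAtoms⁻ A
negAtoms⁻ (atom x) = x ∷ []
negAtoms⁻ (A ∨ B)  = []
negAtoms⁻ (~ A)    = negAtoms⁺ A

PosAt-negAtoms : ∀ {A B p x} → PosAt A B p → x ∈ negAtoms⁺ B → x ∈ negAtoms⁺ A
NegAt-negAtoms : ∀ {A B p x} → NegAt A B p → x ∈ negAtoms⁻ B → x ∈ negAtoms⁺ A
PosAt-negAtoms here           i = i
PosAt-negAtoms (∨ˡ o)         i = PosAt-negAtoms o (∈-++⁺ˡ i)
PosAt-negAtoms (∨ʳ {B = B} o) i = PosAt-negAtoms o (∈-++⁺ʳ (negAtoms⁺ B) i)
PosAt-negAtoms (~⁻ o)         i = NegAt-negAtoms o i
NegAt-negAtoms (~⁺ o)         i = PosAt-negAtoms o i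

NegPart⇒∈ : ∀ {A x} → NegPart A (atom x) → x ∈ negAtoms⁺ A
NegPart⇒∈ (_ , o) = NegAt-negAtoms o (here refl)

negAtoms-PosAt : ∀ {A p x} B → PosAt A B p → x ∈ negAtoms⁺ B → NegPart A (atom x)
negAtoms-NegAt : ∀ {A p x} B → NegAt A B p → x ∈ negAtoms⁻ B → NegPart A (atom x)
negAtoms-PosAt (B ∨ C) o i =
  [ negAtoms-PosAt B (∨ˡ o) , negAtoms-PosAt C (∨ʳ o) ]′ (∈-++⁻ (negAtoms⁺ B) i)
negAtoms-PosAt (~ B)   o i = negAtoms-NegAt B (~⁺ o) i
negAtoms-NegAt (atom x) o (here refl) = _ , o
negAtoms-NegAt (~ B)    o i = negAtoms-PosAt B (~⁻ o) i

∈⇒NegPart : ∀ {A x} → x ∈ negAtoms⁺ A → NegPart A (atom x)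
∈⇒NegPart {A} = negAtoms-PosAt A here

NegPart-closed : ∀ {H} → Hintikka H → Closed (λ x → NegPart H (atom x))
NegPart-closed h = record { closed₁ = neg-ax₁ ; closed₂ = neg-ax₂ ; closed₃ = neg-ax₃ }
  where open Hintikka h

module _ {H} (h : Hintikka H) where
  open Hintikka h

  hintikkaValuation : Valuation
  hintikkaValuation = char (negAtoms⁺ H)

  hintikka-model : Model hintikkaValuation
  hintikka-model = Closed-resp (char-∈ ∘ NegPart⇒∈) (∈⇒NegPart ∘ ∈-char) (NegPart-closed h)

  ¬NegPart-false : ∀ {x} → ¬ NegPart H (atom x) → hintikkaValuation x ≡ false
  ¬NegPart-false {x} ¬n = dec-false (x ∈ᵖ? negAtoms⁺ H) (¬n ∘ ∈⇒NegPart)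

  -- Induction on the part. A true positive atom would also be a negative part, against
  -- `consistent`; for a negative disjunction `neg-∨` supplies the true disjunct.
  hintikka-PosAt : ∀ {p} B → PosAt H B p → eval hintikkaValuation B ≡ false
  hintikka-NegAt : ∀ {p} B → NegAt H B p → eval hintikkaValuation B ≡ true
  hintikka-PosAt (atom x) o = ¬NegPart-false λ (_ , n) →
    consistent (_ , _ , _ , o , n , atom-nonOverlapping o n)
  hintikka-PosAt (B ∨ C) o = cong₂ _or_ (hintikka-PosAt B (∨ˡ o)) (hintikka-PosAt C (∨ʳ o))
  hintikka-PosAt (~ B)   o = cong not (hintikka-NegAt B (~⁺ o))
  hintikka-NegAt (atom x) n = char-∈ (NegPart⇒∈ (_ , n))
  hintikka-NegAt (B ∨ C)  n with neg-∨ B C (_ , n)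
  ... | inj₁ (_ , m) = cong (_or eval hintikkaValuation C) (hintikka-NegAt B m)
  ... | inj₂ (_ , m) = trans (cong (eval hintikkaValuation B or_) (hintikka-NegAt C m)) (∨-zeroʳ _)
  hintikka-NegAt (~ B)    n = cong not (hintikka-PosAt B (~⁻ n))

  hintikka-false : eval hintikkaValuation H ≡ false
  hintikka-false = hintikka-PosAt H here

-- Derivable formulas are falsifiable

HL₁⇒Falsifiable : ∀ {A} → ⊢HL₁ A → Falsifiable A
HL₁⇒Falsifiable (hintikka h) = hintikkaValuation h , hintikka-model h , hintikka-false h
HL₁⇒Falsifiable (detach d e) = Falsifiable-detach d (HL₁⇒Falsifiable e)

HAR⇒Falsifiable : ∀ {a₀ A} → HAR[ a₀ ]⊣ A → Falsifiable A
-- The empty relation falsifies `ε a₀ a₀`; in the next clause the full relation falsifies its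
-- negation.
HAR⇒Falsifiable ax⁺ = const false , record { closed₁ = λ _ _ () ; closed₂ = λ _ _ _ () ; closed₃ = λ _ _ () } , refl
HAR⇒Falsifiable ax⁻ = const true , record { closed₁ = λ _ _ _ → refl ; closed₂ = λ _ _ _ _ _ → refl ; closed₃ = λ _ _ _ _ → refl } , refl
HAR⇒Falsifiable (detach d e) = Falsifiable-detach d (HAR⇒Falsifiable e)
HAR⇒Falsifiable (subst σ {B} e) =
  let (v , m , f) = HAR⇒Falsifiable e in
  -- The pullback of `v` along `σ` gives `B` the value that `v` gives to its renaming.
  (λ (a , b) → v (σ a , σ b)) ,
  record { closed₁ = λ a b → closed₁ m (σ a) (σ b)
         ; closed₂ = λ a b c → closed₂ m (σ a) (σ b) (σ c)
         ; closed₃ = λ a b → closed₃ m (σ a) (σ b) } ,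
  trans (sym (eval-[] v _ B)) f
-- The valuation read off the Hintikka formula falsifies it and makes every atom outside its
-- negative parts false, hence also the new disjunct.
HAR⇒Falsifiable (extend a b h _ _ ¬n) =
  hintikkaValuation h , hintikka-model h , cong₂ _or_ (hintikka-false h) (¬NegPart-false h ¬n)

-- Falsifiable formulas are derivable

PosAt-literals : ∀ {A B p} → LiteralDisjunction A → PosAt A B p → LiteralDisjunction B
NegAt-literals : ∀ {A B p} → LiteralDisjunction A → NegAt A B p → ∃[ x ] B ≡ atom x
PosAt-literals l here = l
PosAt-literals l (∨ˡ o) with PosAt-literals l o
... | k ∨ _ = k
PosAt-literals l (∨ʳ o) with PosAt-literals l o
... | _ ∨ k = k
PosAt-literals l (~⁻ n) with NegAt-literals l n
... | _ , ()
NegAt-literals l (~⁺ o) with PosAt-literals l o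
... | neg a b = (a , b) , refl

-- By `refuted` and `complete` together, the atomic negative parts are exactly the atoms true under
-- `v`. False atoms may be missing, so they can be added one at a time.
record Diagram (v : Valuation) (H : L₁) : Set where
  field
    literals : LiteralDisjunction H
    refuted  : eval v H ≡ false
    complete : ∀ {x} → v x ≡ true → NegPart H (atom x)

open Diagram

Diagram-NegPart : ∀ {v H x} → Diagram v H → NegPart H (atom x) → v x ≡ true
Diagram-NegPart d (_ , n) = NegAt-true (refuted d) n

-- No formula is both true and false under `v`, which gives `consistent`. Negative parts are atoms,
-- so `neg-∨` is vacuous, and the remaining conditions are those of `Model v`.
Diagram⇒Hintikka : ∀ {v H} → Model v → Diagram v H → Hintikka H
Diagram⇒Hintikka {v} {H} m d = record
  { consistent = λ (_ , _ , _ , o , n , _) →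
      true≢false (NegAt-true (refuted d) n) (PosAt-false (refuted d) o)
  ; neg-∨   = λ _ _ (_ , n) → no-∨ n
  ; neg-ax₁ = closed₁ c
  ; neg-ax₂ = closed₂ c
  ; neg-ax₃ = closed₃ c
  }
  where
  c : Closed (λ x → NegPart H (atom x))
  c = Closed-resp (complete d) (Diagram-NegPart d) m

  no-∨ : ∀ {B C p} {X : Set} → NegAt H (B ∨ C) p → X
  no-∨ n with NegAt-literals (literals d) n
  ... | _ , ()

Diagram-∨ : ∀ {v H x} → v x ≡ false → Diagram v H → Diagram v (H ∨ atom x)
Diagram-∨ {x = a , b} f d = record
  { literals = literals d ∨ pos a b
  ; refuted  = cong₂ _or_ (refuted d) f
  ; complete = λ t → let (_ , n) = complete d t in _ , NegAt-∨ˡ n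
  }

-- Deriving diagrams in HAR

negated : Name × Name → List (Name × Name) → L₁
negated x []       = ~ atom x
negated x (y ∷ ys) = ~ atom x ∨ negated y ys

negated-literals : ∀ x xs → LiteralDisjunction (negated x xs)
negated-literals (a , b) []       = neg a b
negated-literals (a , b) (y ∷ ys) = neg a b ∨ negated-literals y ys

negated-false : ∀ {v} x xs → All (λ y → v y ≡ true) (x ∷ xs) → eval v (negated x xs) ≡ false
negated-false x []       (t ∷ [])     = cong not t
negated-false x (y ∷ ys) (t ∷ ts)     = cong₂ _or_ (cong not t) (negated-false y ys ts)

negated-NegPart : ∀ {z} x xs → z ∈ x ∷ xs → NegPart (negated x xs) (atom z)
negated-NegPart x []       (here refl) = _ , ~⁺ here
negated-NegPart x (y ∷ ys) (here refl) = _ , ~⁺ (∨ˡ here)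
negated-NegPart x (y ∷ ys) (there i)   = let (_ , n) = negated-NegPart y ys i in _ , NegAt-∨ʳ n

eval-rename-negated : ∀ v a₀ x xs → eval v (rename (const a₀) (negated x xs)) ≡ not (v (a₀ , a₀))
eval-rename-negated v a₀ x []       = refl
eval-rename-negated v a₀ x (y ∷ ys) =
  trans (cong (not (v (a₀ , a₀)) or_) (eval-rename-negated v a₀ y ys)) (∨-idem _)

-- Under the constant renaming every disjunct becomes `~ ε a₀ a₀`, so the block collapses to `ax⁻`
-- by idempotence; `subst` then undoes the renaming.
HAR-negated : ∀ a₀ x xs → HAR[ a₀ ]⊣ negated x xs
HAR-negated a₀ x xs = subst (const a₀) (detach
  (⊢H-valid-⊃ (rename (const a₀) (negated x xs)) (~ ε a₀ a₀) λ v → trans (eval-rename-negated v a₀ x xs))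
  ax⁻)

HAR-base : ∀ a₀ S → ∃[ H ] (Diagram (char S) H × HAR[ a₀ ]⊣ H)
-- With no true atom there is no block to negate, and no empty disjunction exists, so the false atom
-- `ε a₀ a₀` serves as the start.
HAR-base a₀ [] = ε a₀ a₀ , record { literals = pos a₀ a₀ ; refuted = refl ; complete = λ () } , ax⁺
HAR-base a₀ (x ∷ xs) = negated x xs , record
  { literals = negated-literals x xs
  ; refuted  = negated-false x xs (All.tabulate char-∈)
  ; complete = negated-NegPart x xs ∘ ∈-char
  } , HAR-negated a₀ x xs

-- Each stage is again a diagram, hence a Hintikka formula, and a false atom is not among its
-- negative parts: just what `extend` demands. The positive parts are recorded for the later
-- comparison of valuations.
HAR-extend : ∀ {a₀ v H} → Model v → Diagram v H → HAR[ a₀ ]⊣ H →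
             ∀ xs → All (λ x → v x ≡ false) xs →
             ∃[ K ] (Diagram v K × (HAR[ a₀ ]⊣ K) × All (λ x → PosPart K (atom x)) xs)
HAR-extend {H = H} m d e [] [] = H , d , e , []
HAR-extend m d e ((a , b) ∷ xs) (f ∷ fs) =
  let (K , dK , eK , ps) = HAR-extend m d e xs fs in
  K ∨ ε a b , Diagram-∨ f dK ,
  extend a b (Diagram⇒Hintikka m dK) (literals dK) eK (λ n → true≢false (Diagram-NegPart dK n) f) ,
  ((_ , ∨ʳ here) ∷ All.map (λ (_ , o) → _ , PosAt-∨ˡ o) ps)

-- Restriction to the names of a formula

names : L₁ → List Name
names (ε a b) = a ∷ b ∷ []
names (A ∨ B) = names A ++ names B
names (~ A)   = names A

eval-cong : ∀ {v w : Valuation} A → (∀ {a b} → a ∈ names A → b ∈ names A → v (a , b) ≡ w (a , b)) →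
            eval v A ≡ eval w A
eval-cong (ε a b) h = h (here refl) (there (here refl))
eval-cong (A ∨ B) h = cong₂ _or_
  (eval-cong A λ i j → h (∈-++⁺ˡ i) (∈-++⁺ˡ j))
  (eval-cong B λ i j → h (∈-++⁺ʳ (names A) i) (∈-++⁺ʳ (names A) j))
eval-cong (~ A)   h = cong not (eval-cong A h)

module _ {v : Valuation} (m : Model v) (N : List Name) where

  valued : Bool → List (Name × Name)
  valued t = filter (λ x → v x ≟ᵇ t) (cartesianProduct N N)

  ∈-valued⁺ : ∀ {t a b} → a ∈ N → b ∈ N → v (a , b) ≡ t → (a , b) ∈ valued t
  ∈-valued⁺ i j = ∈-filter⁺ (λ x → v x ≟ᵇ _) (∈-cartesianProduct⁺ i j)

  ∈-valued⁻ : ∀ {t x} → x ∈ valued t → (proj₁ x ∈ N × proj₂ x ∈ N) × v x ≡ t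
  ∈-valued⁻ i = let (k , e) = ∈-filter⁻ (λ x → v x ≟ᵇ _) i in ∈-cartesianProduct⁻ N N k , e

  -- The conclusion of each scheme contains only names from its premises, so closure never leads
  -- outside `N`.
  valued-closed : Closed (_∈ valued true)
  valued-closed = record
    { closed₁ = λ a b p →
        let ((i , j) , t) = ∈-valued⁻ p in ∈-valued⁺ i i (closed₁ m a b t)
    ; closed₂ = λ a b c p q →
        let ((i , _) , t) = ∈-valued⁻ p
            ((_ , k) , u) = ∈-valued⁻ q in ∈-valued⁺ i k (closed₂ m a b c t u)
    ; closed₃ = λ a b p q →
        let ((i , j) , t) = ∈-valued⁻ p
            (_ , u)       = ∈-valued⁻ q in ∈-valued⁺ j i (closed₃ m a b t u)
    }

  restriction-model : Model (char (valued true))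
  restriction-model = Closed-resp char-∈ ∈-char valued-closed

  restriction-false : ∀ {x} → x ∈ valued false → char (valued true) x ≡ false
  restriction-false {x} i = dec-false (x ∈ᵖ? valued true) λ j →
    true≢false (proj₂ (∈-valued⁻ j)) (proj₂ (∈-valued⁻ i))

-- Every pair of names of `A` is a negative part of `H` if true under `v` and a positive part if
-- false. A valuation falsifying `H` therefore agrees with `v` on these pairs and falsifies `A`.
Falsifiable⇒diagram : ∀ a₀ {A} → Falsifiable A → ∃[ H ] (Hintikka H × (HAR[ a₀ ]⊣ H) × (⊢H A ⊃ H))
Falsifiable⇒diagram a₀ {A} (v , m , f) =
  H , Diagram⇒Hintikka m′ d , e , ⊢H-valid-⊃ A H λ w g →
    trans (eval-cong A λ i j → agree w g i j) f
  where
  N  = names A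
  m′ = restriction-model m N
  base = HAR-base a₀ (valued m N true)
  ext = HAR-extend m′ (proj₁ (proj₂ base)) (proj₂ (proj₂ base))
          (valued m N false) (All.tabulate (restriction-false m N))
  H = proj₁ ext
  d = proj₁ (proj₂ ext)
  e = proj₁ (proj₂ (proj₂ ext))
  ps = proj₂ (proj₂ (proj₂ ext))

  agree : ∀ w → eval w H ≡ false → ∀ {a b} → a ∈ N → b ∈ N → w (a , b) ≡ v (a , b)
  agree w g {a} {b} i j with v (a , b) in eq
  ... | true  = NegAt-true g (proj₂ (complete d (char-∈ (∈-valued⁺ m N i j eq))))
  ... | false = PosAt-false g (proj₂ (All.lookup ps (∈-valued⁺ m N i j eq)))

theorem9p3 : (a₀ : Name) (A : L₁) → (⊢HL₁ A) ⇔ (HAR[ a₀ ]⊣ A)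
theorem9p3 a₀ A = mk⇔
  (λ p → let (_ , _ , e , d) = Falsifiable⇒diagram a₀ (HL₁⇒Falsifiable p) in detach d e)
  (λ p → let (_ , h , _ , d) = Falsifiable⇒diagram a₀ (HAR⇒Falsifiable p) in detach d (hintikka h))
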